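{- Let $c$ be an integer. If a graph $G$ has no cycle of length greater than $c$, then \[\mathrm{HG}(G) < \left( \frac{64}{25} \right)^{2^{\lfloor \frac{1}{2}c^2 \rfloor - 1}} + \frac{1}{2}.\]
   Context: All graphs are finite, simple and undirected. For a vertex $v$ of a graph $G$, $N(v)$ denotes its set of neighbors, and $[q]=\{1,\dots,q\}$. The length of a cycle is its number of edges. The right-hand side is $(64/25)$ raised to the power $2^{\lfloor c^2/2\rfloor - 1}$, plus $1/2$. Hat guessing game on $G$ with $q$ colors: a guessing strategy is a family of functions $\Gamma = \{\Gamma_v : v\in V(G)\}$ with $\Gamma_v : [q]^{N(v)} \to [q]$. A hat assignment is a (not necessarily proper) coloring $\varphi : V(G)\to[q]$. The player at $v$ guesses correctly if $\Gamma_v(\varphi|_{N(v)}) = \varphi(v)$. The strategy $\Gamma$ is winning for the players if for every hat assignment $\varphi$ at least one vertex $v$ guesses correctly. The hat guessing number $\mathrm{HG}(G)$ is the maximum integer $q$ such that the players have a winning guessing strategy on $G$ with $q$ colors. -}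

module Defs where

open import Algebra.Definitions.RawSemiring using () renaming (_^_ to pow)
open import Data.Bool.Base using (Bool; false; T)
open import Data.Fin.Base using (Fin)
open import Data.Integer.Base using (+_)
open import Data.List.Base using (List; []; _∷_; _++_; length)
open import Data.List.Relation.Unary.Linked using (Linked)
open import Data.List.Relation.Unary.Unique.Propositional using (Unique)
open import Data.Nat.Base using (ℕ; zero; suc; _≤_)
import Data.Nat.Base as ℕ
open import Data.Product.Base using (∃; _×_; proj₁)
open import Data.Rational.Base using (ℚ; _/_; _*_; +-*-rawSemiring)
open import Function.Base using (_∘_)
open import Relation.Binary.PropositionalEquality using (_≡_; refl; _≗_)

record Graph (n : ℕ) : Set where
  field
    adj     : Fin n → Fin n → Bool
    adj-sym : ∀ u v → adj u v ≡ adj v u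
    no-loop : ∀ v → adj v v ≡ false

  Adj : Fin n → Fin n → Set
  Adj u v = T (adj u v)

  N : Fin n → Set
  N v = ∃ λ u → Adj v u

-- The cycle start, v₁, …, vₖ, start. It has as many edges as listed vertices.
record Cycle {n : ℕ} (G : Graph n) : Set where
  open Graph G
  field
    start    : Fin n
    rest     : List (Fin n)

  vertices : List (Fin n)
  vertices = start ∷ rest

  len : ℕ
  len = length vertices

  field
    distinct : Unique vertices
    edges    : Linked Adj (vertices ++ start ∷ [])
    3≤len    : 3 ≤ len

-- Γ_v is a function on [q]^{N(v)}, whose elements are themselves functions;
-- in the absence of function extensionality, guess-cong states that
-- Γ_v depends only on the colours it sees.
record Strategy {n : ℕ} (G : Graph n) (q : ℕ) : Set where
  open Graph G
  field
    guess      : ∀ v → (N v → Fin q) → Fin q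
    guess-cong : ∀ v {f g : N v → Fin q} → f ≗ g → guess v f ≡ guess v g

Winning : ∀ {n} {G : Graph n} {q} → Strategy G q → Set
Winning {n} {q = q} Γ =
  (φ : Fin n → Fin q) → ∃ λ v → Strategy.guess Γ v (φ ∘ proj₁) ≡ φ v

PlayersWin : ∀ {n} → Graph n → ℕ → Set
PlayersWin G q = ∃ λ (Γ : Strategy G q) → Winning Γ

-- HG(G) = h. The graph without vertices has no hat guessing number:
-- nobody guesses there, so no q is a win for the players.
IsHG : ∀ {n} → Graph n → ℕ → Set
IsHG G h = PlayersWin G h × (∀ q → PlayersWin G q → q ≤ h)

infixr 8 _^_
_^_ : ℚ → ℕ → ℚ
_^_ = pow +-*-rawSemiring

-- (64/25) to the power 2^(k-1), where k-1 is an integer subtraction: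
-- for k = 0 the exponent is 1/2 and the value is the positive square root 8/5.
[64/25]^2^⟨_-1⟩ : ℕ → ℚ
[64/25]^2^⟨ zero  -1⟩ = + 8 / 5
[64/25]^2^⟨ suc m -1⟩ = (+ 64 / 25) ^ (2 ℕ.^ m)

[64/25]^½-squared : [64/25]^2^⟨ 0 -1⟩ * [64/25]^2^⟨ 0 -1⟩ ≡ + 64 / 25
[64/25]^½-squared = refl

{-# OPTIONS --safe #-}
module Submission where

-- Let V be cut along a vertex p, with S a minimal set attached to the rest only through p. On S the
-- players are beaten along a depth-first search tree: when M colourings of the ancestors must be
-- beaten simultaneously by one colouring of the subtree of v, the subtrees below v are first coloured
-- against M + 1 candidate colours of v; the at most M guesses of v then miss one of the candidates.
-- At depth D this needs q > M(D), where M(0) = 1 and M(D + 1) = M(D) (M(D) + 1), so M(D) + 1 is Sylvester's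
-- sequence. Doing this for any two colours of p leaves at most one bad colour of p for each colouring
-- of its other neighbours, so that S can be deleted and the bad colour declared the guess of p.
--
-- By minimality of S, every subtree below depth 1 is joined to an ancestor above its parent. A greedy
-- choice of such back edges gives a cycle showing 2D ≤ c², whence the bound.

open import Defs

module HatGuessing where
  open import Data.Bool.Base using (T; if_then_else_)
  open import Data.Bool.Properties using (T?)
  open import Data.Empty using (⊥-elim)
  open import Data.Fin.Base using (Fin; zero; suc; inject≤; remQuot; combine)
  open import Data.Fin.Properties as Fin using (any?; all?; _≟_)
  open import Data.Fin.Subset hiding (inside; outside)
  open import Data.Fin.Subset.Properties
  open import Data.List.Base using (List; []; _∷_; _++_; length; reverse)
  open import Data.List.Properties using (length-++; length-reverse; unfold-reverse)
  open import Data.List.Membership.Propositional using () renaming (_∈_ to _∈ᴸ_)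
  open import Data.List.Membership.Propositional.Properties using (∈-++⁻)
  open import Data.List.Relation.Binary.Permutation.Propositional using (↭-sym; ↭⇒↭ₛ)
  open import Data.List.Relation.Binary.Permutation.Propositional.Properties using (↭-reverse; ∈-resp-↭)
  import Data.List.Relation.Binary.Permutation.Setoid.Properties as ↭ₛ
  open import Data.List.Relation.Unary.Any using (here; there)
  open import Data.List.Relation.Unary.All using ([])
  open import Data.List.Relation.Unary.AllPairs using ([]; _∷_)
  open import Data.List.Relation.Unary.Linked using (Linked; [-]; _∷_)
  open import Data.List.Relation.Unary.Unique.Propositional using (Unique)
  import Data.List.Relation.Unary.Unique.Propositional.Properties as Unique
  open import Data.Nat.Base as ℕ using (ℕ; zero; suc; _+_; _*_; _≤_; _<_; z≤n; s≤s)
  import Data.Nat.Properties as ℕ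
  open import Data.Nat.Tactic.RingSolver using (solve-∀)
  open import Data.Product.Base using (∃; ∃₂; _×_; _,_; proj₁; proj₂)
  open import Data.Sum.Base using (_⊎_; inj₁; inj₂; [_,_]′)
  open import Data.Vec.Base using (_∷_; here; there)
  open import Function.Base using (_∘_; id; case_of_)
  open import Relation.Binary.PropositionalEquality
    using (_≡_; _≢_; refl; sym; trans; cong; subst; setoid)
  open import Relation.Nullary using (¬_; Dec; yes; no; does; contradiction)
  open import Relation.Nullary.Decidable using (_×-dec_; _⊎-dec_; _→-dec_; ¬?; dec-true; dec-false)
  open import Relation.Unary using (Decidable)

  -- Finite searches and subsets.

  greatest : ∀ {P : ℕ → Set} → Decidable P → ∀ D {j} → j ≤ D → P j →
             ∃ λ m → m ≤ D × P m × (∀ {i} → i ≤ D → P i → i ≤ m)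
  greatest P? D j≤D pj with P? D
  greatest P? D j≤D pj | yes pD = D , ℕ.≤-refl , pD , λ i≤D _ → i≤D
  greatest P? zero z≤n pj | no ¬p0 = contradiction pj ¬p0
  greatest {P} P? (suc D) j≤D pj | no ¬pD =
    let m , m≤D , pm , max = greatest P? D (below j≤D pj) pj
    in m , ℕ.m≤n⇒m≤1+n m≤D , pm , λ i≤D pi → max (below i≤D pi) pi
    where
    below : ∀ {i} → i ≤ suc D → P i → i ≤ D
    below i≤D pi = ℕ.≤-pred (ℕ.≤∧≢⇒< i≤D λ { refl → ¬pD pi })

  -- Along the nested subtrees of a branch this finds the position at which `x` hangs off the
  -- branch.
  locate : ∀ {n} (S : ℕ → Subset n) {x} b k → x ∉ S b → x ∈ S (k + b) →
           ∃ λ i → i < k × x ∉ S (i + b) × x ∈ S (suc (i + b))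
  locate S b zero x∉ x∈ = contradiction x∈ x∉
  locate S {x} b (suc k) x∉ x∈ with x ∈? S (k + b)
  ... | no  x∉k = k , ℕ.≤-refl , x∉k , x∈
  ... | yes x∈k =
    let i , i<k , p = locate S b k x∉ x∈k in i , ℕ.m≤n⇒m≤1+n i<k , p

  gap : ∀ {b a} → b < a → ∃ λ k → suc (k + b) ≡ a
  gap {b} {suc a} (s≤s b≤a) = a ℕ.∸ b , cong suc (ℕ.m∸n+n≡m b≤a)

  x∈p─q⇒x∉q : ∀ {n} {p q : Subset n} {x} → x ∈ p ─ q → x ∉ q
  x∈p─q⇒x∉q {p = _ ∷ _} {inside ∷ _}  ()         here
  x∈p─q⇒x∉q {p = _ ∷ _} {_ ∷ _}       (there x∈) (there x∈q) = x∈p─q⇒x∉q x∈ x∈q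

  -- Walks, paths and cycles.

  module Branches {n : ℕ} (G : Graph n) where
    open Graph G

    Adj-sym : ∀ {u v} → Adj u v → Adj v u
    Adj-sym {u} {v} = subst T (adj-sym u v)

    Adj? : ∀ u v → Dec (Adj u v)
    Adj? u v = T? (adj u v)

    Adj-irrefl : ∀ {v} → ¬ Adj v v
    Adj-irrefl {v} = subst T (no-loop v)

    data Walk : Fin n → Fin n → List (Fin n) → Set where
      [-] : ∀ {u} → Walk u u (u ∷ [])
      _∷_ : ∀ {u v w vs} → Adj u v → Walk v w vs → Walk u w (u ∷ vs)

    Walk-++ : ∀ {u v w z xs ys} → Walk u v xs → Adj v w → Walk w z ys → Walk u z (xs ++ ys)
    Walk-++ [-]       e q = e ∷ q
    Walk-++ (e′ ∷ p) e q = e′ ∷ Walk-++ p e q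

    Walk-reverse : ∀ {u v xs} → Walk u v xs → Walk v u (reverse xs)
    Walk-reverse [-] = [-]
    Walk-reverse (_∷_ {u} {vs = vs} e p) =
      subst (Walk _ _) (sym (unfold-reverse u vs)) (Walk-++ (Walk-reverse p) (Adj-sym e) [-])

    Walk-length : ∀ {u v xs} → Walk u v xs → 1 ≤ length xs
    Walk-length [-]     = s≤s z≤n
    Walk-length (_ ∷ _) = s≤s z≤n

    -- r counts vertices
    record Path (S : Subset n) (u v : Fin n) (r : ℕ) : Set where
      field
        list     : List (Fin n)
        walk     : Walk u v list
        unique   : Unique list
        within   : ∀ {x} → x ∈ᴸ list → x ∈ S
        length≡  : length list ≡ r

    open Path

    path-nonempty : ∀ {S u v r} → Path S u v r → 1 ≤ r
    path-nonempty p = subst (1 ≤_) (length≡ p) (Walk-length (walk p))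

    widen : ∀ {S T u v r} → S ⊆ T → Path S u v r → Path T u v r
    widen S⊆T p = record
      { list = list p ; walk = walk p ; unique = unique p
      ; within = λ x∈ → S⊆T (within p x∈) ; length≡ = length≡ p }

    trivial : ∀ {S u} → u ∈ S → Path S u u 1
    trivial u∈S = record
      { list = _ ; walk = [-] ; unique = [] ∷ [] ; within = λ { (here refl) → u∈S } ; length≡ = refl }

    join : ∀ {S T X u v w z r s} → Path S u v r → Adj v w → Path T w z s →
           (∀ {x} → x ∈ S → x ∉ T) → S ⊆ X → T ⊆ X → Path X u z (r + s)
    join p e q S#T S⊆X T⊆X = record
      { list    = list p ++ list q
      ; walk    = Walk-++ (walk p) e (walk q)
      ; unique  = Unique.++⁺ (unique p) (unique q) λ (x∈p , x∈q) → S#T (within p x∈p) (within q x∈q)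
      ; within  = λ x∈ → [ (λ i → S⊆X (within p i)) , (λ i → T⊆X (within q i)) ]′ (∈-++⁻ (list p) x∈)
      ; length≡ = trans (length-++ (list p))
                        (trans (cong (_+ _) (length≡ p)) (cong (_ +_) (length≡ q)))
      }

    reversed : ∀ {S u v r} → Path S u v r → Path S v u r
    reversed p = record
      { list    = reverse (list p)
      ; walk    = Walk-reverse (walk p)
      ; unique  = ↭ₛ.Unique-resp-↭ (setoid (Fin n)) (↭⇒↭ₛ (↭-sym (↭-reverse (list p)))) (unique p)
      ; within  = λ x∈ → within p (∈-resp-↭ (↭-reverse (list p)) x∈)
      ; length≡ = trans (length-reverse (list p)) (length≡ p)
      }

    Walk⇒Linked : ∀ {u v w xs} → Walk u v xs → Adj v w → Linked Adj (xs ++ w ∷ [])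
    Walk⇒Linked [-]                 f = f ∷ [-]
    Walk⇒Linked (e ∷ [-])           f = e ∷ Walk⇒Linked [-] f
    Walk⇒Linked (e ∷ p@(_ ∷ _))     f = e ∷ Walk⇒Linked p f

    closeCycle : ∀ {S u v r} → Path S u v r → Adj v u → 3 ≤ r → ∃ λ (C : Cycle G) → Cycle.len C ≡ r
    closeCycle record { list = .(_ ∷ _) ; walk = [-] ; unique = uq ; length≡ = refl } f (s≤s ())
    closeCycle record { list = .(_ ∷ _) ; walk = e ∷ p ; unique = uq ; length≡ = refl } f 3≤r =
      record { start = _ ; rest = _ ; distinct = uq ; edges = Walk⇒Linked (e ∷ p) f ; 3≤len = 3≤r } , refl

    -- The paths found so far stay inside the explored set `U`, so prefixing a vertex outside `U`
    -- keeps them simple. The fuel `m` bounds the number of unexplored vertices.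
    reach : ∀ {S r} → r ∈ S →
            (∀ U {y} → U ⊆ S → r ∈ U → y ∈ S → y ∉ U → ∃₂ λ u w → u ∈ U × w ∈ S × w ∉ U × Adj u w) →
            ∀ {x} → x ∈ S → ∃ (Path S x r)
    reach {S} {r} r∈S grow = go n ⁅ r ⁆ (ℕ.m≤m+n n _) (λ x∈ → subst (_∈ S) (sym (x∈⁅y⁆⇒x≡y r x∈)) r∈S) (x∈⁅x⁆ r)
      λ x∈ → 1 , subst (λ x → Path _ x r 1) (sym (x∈⁅y⁆⇒x≡y r x∈)) (trivial (x∈⁅x⁆ r))
      where
      go : ∀ m U → n ≤ m + ∣ U ∣ → U ⊆ S → r ∈ U → (∀ {x} → x ∈ U → ∃ (Path U x r)) →
           ∀ {x} → x ∈ S → ∃ (Path S x r)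
      go m U fuel U⊆S r∈U paths {x} x∈S with x ∈? U
      ... | yes x∈U = let k , p = paths x∈U in k , widen U⊆S p
      ... | no  x∉U with grow U U⊆S r∈U x∈S x∉U
      ... | u , w , u∈U , w∈S , w∉U , e = next m fuel
        where
        U′ = U ∪ ⁅ w ⁆

        U⊆U′ : U ⊆ U′
        U⊆U′ = x∈p∪q⁺ ∘ inj₁

        w⊆U′ : ⁅ w ⁆ ⊆ U′
        w⊆U′ = x∈p∪q⁺ ∘ inj₂

        larger : ∣ U ∣ < ∣ U′ ∣
        larger = p⊂q⇒∣p∣<∣q∣ (U⊆U′ , w , w⊆U′ (x∈⁅x⁆ w) , w∉U)

        is-w : ∀ {y} → y ∈ ⁅ w ⁆ → y ≡ w
        is-w = x∈⁅y⁆⇒x≡y w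

        paths′ : ∀ {y} → y ∈ U′ → ∃ (Path U′ y r)
        paths′ y∈ with x∈p∪q⁻ U ⁅ w ⁆ y∈
        ... | inj₁ y∈U = let k , p = paths y∈U in k , widen U⊆U′ p
        ... | inj₂ y∈w with refl ← is-w y∈w =
          let k , p = paths u∈U
          in suc k , join (trivial (x∈⁅x⁆ w)) (Adj-sym e) p
                    (λ z∈w z∈U → w∉U (subst (_∈ U) (is-w z∈w) z∈U)) w⊆U′ U⊆U′

        next : ∀ m → n ≤ m + ∣ U ∣ → ∃ (Path S x r)
        next zero    fuel = contradiction (ℕ.≤-trans (ℕ.≤-trans (s≤s fuel) larger) (∣p∣≤n U′)) (ℕ.<-irrefl refl)
        next (suc m) fuel = go m U′
          (ℕ.≤-trans fuel (ℕ.≤-trans (ℕ.≤-reflexive (sym (ℕ.+-suc m ∣ U ∣))) (ℕ.+-monoʳ-≤ m larger)))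
          (λ y∈ → [ U⊆S , (λ y∈w → subst (_∈ S) (sym (is-w y∈w)) w∈S) ]′ (x∈p∪q⁻ U ⁅ w ⁆ y∈))
          (U⊆U′ r∈U) paths′ x∈S

    -- Branches of depth-first search trees.

    Connected : Subset n → Set
    Connected S = ∀ U {x y} → x ∈ S → x ∈ U → y ∈ S → y ∉ U →
                  ∃₂ λ u w → u ∈ S × u ∈ U × w ∈ S × w ∉ U × Adj u w

    -- A step of depth-first search: T′ is a component of S minus v, entered at w.
    record Link (parent child : Fin n × Subset n) : Set where
      v = proj₁ parent
      S = proj₂ parent
      w = proj₁ child
      T′ = proj₂ child
      field
        v∈S       : v ∈ S
        v∉T       : v ∉ T′
        T⊆S       : T′ ⊆ S
        w∈T       : w ∈ T′
        edge      : Adj v w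
        connected : Connected T′
        closed    : ∀ {x y} → x ∈ T′ → y ∈ S → Adj x y → y ∈ T′ ⊎ y ≡ v

    Branch : Set
    Branch = ℕ → Fin n × Subset n

    -- A branch of a depth-first search tree: position 0 is the deepest vertex, position D the root,
    -- and the set at a position is the vertex set of the subtree there.
    record IsBranch (σ : Branch) (D : ℕ) : Set where
      vertex : ℕ → Fin n
      vertex = proj₁ ∘ σ

      subtree : ℕ → Subset n
      subtree = proj₂ ∘ σ

      field
        link     : ∀ i → i < D → Link (σ (suc i)) (σ i)
        backEdge : ∀ i → suc i < D →
                   ∃₂ λ j x → suc i < j × j ≤ D × x ∈ subtree i × Adj x (vertex j)

    -- Long cycles from deep branches.

    module _ (m : ℕ) (circumference : ∀ (C : Cycle G) → Cycle.len C ≤ suc m)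
             {σ : Branch} {D : ℕ} (branch : IsBranch σ D) where
      open IsBranch branch

      subtree-mono : ∀ i k → k + i ≤ D → subtree i ⊆ subtree (k + i)
      subtree-mono i zero    le x∈ = x∈
      subtree-mono i (suc k) le x∈ = Link.T⊆S (link (k + i) le) (subtree-mono i k (ℕ.<⇒≤ le) x∈)

      subtree-mono′ : ∀ {i j} → i ≤ j → j ≤ D → subtree i ⊆ subtree j
      subtree-mono′ {i} {j} i≤j j≤D =
        subst (λ z → subtree i ⊆ subtree z) (ℕ.m∸n+n≡m i≤j)
          (subtree-mono i (j ℕ.∸ i) (subst (_≤ D) (sym (ℕ.m∸n+n≡m i≤j)) j≤D))

      ascend : ∀ {u z r} i → i < D → Path (subtree i) u z r → Adj u (vertex (suc i)) →
               Path (subtree (suc i)) (vertex (suc i)) z (suc r)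
      ascend i i<D p e =
        join (trivial (x∈⁅x⁆ _)) (Adj-sym e) p
          (λ x∈v x∈ → Link.v∉T l (subst (_∈ _) (x∈⁅y⁆⇒x≡y _ x∈v) x∈))
          (λ x∈v → subst (_∈ _) (sym (x∈⁅y⁆⇒x≡y _ x∈v)) (Link.v∈S l))
          (Link.T⊆S l)
        where l = link i i<D

      climb : ∀ {u z r} b k → k + b < D → Path (subtree b) u z r → Adj u (vertex (suc b)) →
              ∃ λ u′ → Path (subtree (k + b)) u′ z (k + r) × Adj u′ (vertex (suc (k + b)))
      climb b zero    lt p e = _ , p , e
      climb b (suc k) lt p e =
        let u , q , f = climb b k (ℕ.<⇒≤ lt) p e
        in vertex (suc (k + b)) , ascend (k + b) (ℕ.<⇒≤ lt) q f , Adj-sym (Link.edge (link (suc (k + b)) lt))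

      -- The path and the branch positions `suc b` to `a` form a cycle with a - b + r vertices; the
      -- bound is written without subtraction. Since `suc b < a`, there are at least three vertices.
      closeUp : ∀ {u z r} b {a} → suc b < a → a ≤ D → Path (subtree b) u z r →
                Adj u (vertex (suc b)) → Adj z (vertex a) → a + r ≤ suc m + b
      closeUp {r = r} b {a} sb<a a≤D p e f with gap (ℕ.<⇒≤ sb<a)
      ... | k , refl =
        let u , q , g = climb b k a≤D p e
            C , len   = closeCycle (ascend (k + b) a≤D q g) f (s≤s (ℕ.+-mono-≤ k≥1 (path-nonempty p)))
        in begin
          suc (k + b) + r     ≡⟨ rearrange k b r ⟩
          suc (k + r) + b     ≡⟨ cong (_+ b) len ⟨
          Cycle.len C + b     ≤⟨ ℕ.+-monoˡ-≤ b (circumference C) ⟩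
          suc m + b           ∎
        where
        open ℕ.≤-Reasoning
        k≥1 : 1 ≤ k
        k≥1 = ℕ.+-cancelʳ-≤ b 1 k (ℕ.≤-pred sb<a)

        rearrange : ∀ k b r → suc (k + b) + r ≡ suc (k + r) + b
        rearrange = solve-∀

      touches? : ∀ i → Decidable (λ j → ∃ λ x → x ∈ subtree i × Adj x (vertex j))
      touches? i j = any? λ x → (x ∈? subtree i) ×-dec Adj? x (vertex j)

      -- As position a is the highest one adjacent to the subtree at b, the next back edge, from the
      -- subtree below a to above a, leaves the branch strictly above b and so avoids the path built so
      -- far. When a is the root, closing the path up along the branch gives the long cycle.
      lengthen : ∀ f b {a u z r} → D ≤ f + a → suc b < a → a ≤ D → Path (subtree b) u z r →
                 Adj u (vertex (suc b)) → Adj z (vertex a) →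
                 (∀ {x j} → x ∈ subtree b → j ≤ D → Adj x (vertex j) → j ≤ a) →
                 a + suc b ≤ suc (m * r) → D + D ≤ suc m * suc m
      lengthen f b {a} {r = r} fuel sb<a a≤D p e g highest bound = case a ℕ.≟ D of λ where
          (yes a≡D) → atRoot a≡D
          (no  a≢D) → below f fuel (ℕ.≤∧≢⇒< a≤D a≢D)
        where
        open ℕ.≤-Reasoning

        closed-r : a + r ≤ suc m + b
        closed-r = closeUp b sb<a a≤D p e g

        r<m : r < m
        r<m = ℕ.+-cancelʳ-≤ (suc b) (suc r) m (begin
          suc r + suc b   ≡⟨ ℕ.+-comm (suc r) (suc b) ⟩
          suc b + suc r   ≡⟨ ℕ.+-suc (suc b) r ⟩
          suc (suc b) + r ≤⟨ ℕ.+-monoˡ-≤ r sb<a ⟩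
          a + r           ≤⟨ closed-r ⟩
          suc m + b       ≡⟨ ℕ.+-suc m b ⟨
          m + suc b       ∎)

        -- With c = `suc m`, `closed-r` gives D ≤ c + b and `bound` gives D + b + 1 ≤ mc + 1, so 2D
        -- ≤ c + mc = c².
        atRoot : a ≡ D → D + D ≤ suc m * suc m
        atRoot refl = ℕ.+-cancelʳ-≤ (suc b) _ _ (begin
          D + D + suc b               ≡⟨ ℕ.+-assoc D D (suc b) ⟩
          D + (D + suc b)             ≤⟨ ℕ.+-mono-≤ (ℕ.≤-trans (ℕ.m≤m+n D r) closed-r) bound ⟩
          (suc m + b) + suc (m * r)   ≤⟨ ℕ.+-monoʳ-≤ (suc m + b) (s≤s (ℕ.*-monoʳ-≤ m r≤c)) ⟩
          (suc m + b) + suc (m * suc m) ≡⟨ rearrange (m * suc m) m b ⟩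
          suc m * suc m + suc b       ∎)
          where
          r≤c : r ≤ suc m
          r≤c = ℕ.≤-trans (ℕ.<⇒≤ r<m) (ℕ.n≤1+n m)

          rearrange : ∀ p m b → (suc m + b) + suc p ≡ suc m + p + suc b
          rearrange = solve-∀

        below : ∀ f → D ≤ f + a → a < D → D + D ≤ suc m * suc m
        below zero    fuel a<D = contradiction fuel (ℕ.<⇒≱ a<D)
        below (suc f) fuel a<D with gap sb<a
        ... | K , refl with backEdge (K + suc b) a<D
        ... | j , x₀ , a<j , j≤D , x₀∈ , x₀~j
          with greatest (touches? (K + suc b)) D j≤D (x₀ , x₀∈ , x₀~j)
        ... | a′ , a′≤D , (x , x∈ , x~a′) , highest′
          -- `x` has a neighbour above `a`, the highest one possible for the subtree at `b`, so it
          -- lies outside that subtree. It therefore hangs off at a position `t` strictly between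
          -- `b` and `a`.
          with locate subtree b (suc K)
                 (λ x∈b → ℕ.<⇒≱ (ℕ.<-≤-trans a<j (highest′ j≤D (x₀ , x₀∈ , x₀~j)))
                                 (highest x∈b a′≤D x~a′))
                 (subst (λ i → x ∈ subtree i) (ℕ.+-suc K b) x∈)
        ... | k , s≤s k≤K , x∉k , x∈k =
          lengthen f a₀ (ℕ.≤-trans fuel (ℕ.≤-trans (ℕ.≤-reflexive (sym (ℕ.+-suc f a))) (ℕ.+-monoʳ-≤ f a<a′)))
            a<a′ a′≤D newPath g x~a′ (λ x∈ j≤D e → highest′ j≤D (_ , x∈ , e)) bound′
          where
          a₀ = K + suc b
          t  = suc (k + b)
          t<a : t < a
          t<a = s≤s (subst (t ≤_) (sym (ℕ.+-suc K b)) (s≤s (ℕ.+-monoˡ-≤ b k≤K)))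
          t<D : t < D
          t<D = ℕ.<-trans t<a a<D
          l = link (k + b) (ℕ.<⇒≤ t<D)
          L = link t t<D
          a<a′ : a < a′
          a<a′ = ℕ.<-≤-trans a<j (highest′ j≤D (x₀ , x₀∈ , x₀~j))
          W = subtree t ─ subtree (k + b)

          ear : ∃ (Path W x (vertex t))
          ear = reach (x∈p∧x∉q⇒x∈p─q (Link.v∈S l) (Link.v∉T l)) grow (x∈p∧x∉q⇒x∈p─q x∈k x∉k)
            where
            grow : ∀ U {y} → U ⊆ W → vertex t ∈ U → y ∈ W → y ∉ U → ∃₂ λ u w → u ∈ U × w ∈ W × w ∉ U × Adj u w
            grow U U⊆W v∈U y∈W y∉U
              -- Removing the child subtree does not disconnect the rest: a crossing edge that
              -- starts in the removed part can only lead to the vertex at `t`, which is already in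
              -- `U`.
              with Link.connected L (U ∪ subtree (k + b)) (Link.v∈S l) (x∈p∪q⁺ (inj₁ v∈U))
                     (p─q⊆p _ _ y∈W) (λ y∈ → [ y∉U , x∈p─q⇒x∉q y∈W ]′ (x∈p∪q⁻ U _ y∈))
            ... | u , w , u∈S , u∈ , w∈S , w∉ , u~w with x∈p∪q⁻ U _ u∈
            ... | inj₁ u∈U = u , w , u∈U , x∈p∧x∉q⇒x∈p─q w∈S (w∉ ∘ x∈p∪q⁺ ∘ inj₂) , w∉ ∘ x∈p∪q⁺ ∘ inj₁ , u~w
            ... | inj₂ u∈T with Link.closed l u∈T w∈S u~w
            ... | inj₁ w∈T = contradiction (x∈p∪q⁺ (inj₂ w∈T)) w∉
            ... | inj₂ refl = contradiction (x∈p∪q⁺ (inj₁ v∈U)) w∉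

          s  = proj₁ ear
          up = climb b k (ℕ.<⇒≤ t<D) p e

          -- From `x` through the ear to position `t`, down the branch to `suc b`, then along the
          -- old path to `z`. Reversed, it starts at `z`, and `a = suc a₀` takes over the role of
          -- `suc b`.
          newPath : Path (subtree a₀) _ x (s + (k + r))
          newPath = reversed (join (proj₂ ear) (Adj-sym (proj₂ (proj₂ up))) (proj₁ (proj₂ up))
            (λ y∈W → x∈p─q⇒x∉q y∈W)
            (λ y∈W → subtree-mono′ (ℕ.≤-pred t<a) (ℕ.≤-trans (ℕ.n≤1+n _) (ℕ.<⇒≤ a<D)) (p─q⊆p _ _ y∈W))
            (subtree-mono′ (ℕ.≤-trans (ℕ.n≤1+n _) (ℕ.≤-pred t<a)) (ℕ.≤-trans (ℕ.n≤1+n _) (ℕ.<⇒≤ a<D))))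

          span : a′ + s ≤ suc m + t
          span = closeUp t (ℕ.≤-trans (s≤s t<a) a<a′) a′≤D (reversed (widen (p─q⊆p _ _) (proj₂ ear)))
                   (Adj-sym (Link.edge L)) x~a′

          -- `span` bounds the cycle made of the ear and the branch above `t`. Added to the old
          -- `bound`, it shows that the growth from `a + suc b` to `a′ + a` is covered by `m` per
          -- new vertex, as `s` is at least 1.
          bound′ : a′ + a ≤ suc (m * (s + (k + r)))
          bound′ = ℕ.+-cancelʳ-≤ (s + suc b) _ _ (begin
            (a′ + a) + (s + suc b)              ≡⟨ regroup a′ a s (suc b) ⟩
            (a′ + s) + (a + suc b)              ≤⟨ ℕ.+-mono-≤ span bound ⟩
            (suc m + t) + suc (m * r)           ≡⟨ split m k b (m * r) ⟩
            (m + k + suc (m * r) + 1) + suc b     ≤⟨ ℕ.+-monoˡ-≤ (suc b)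
              (ℕ.+-mono-≤ (ℕ.+-monoˡ-≤ (suc (m * r)) (ℕ.+-mono-≤ m≤ms k≤mk)) s≥1) ⟩
            (m * s + m * k + suc (m * r) + s) + suc b ≡⟨ collect m s k r (suc b) ⟩
            suc (m * (s + (k + r))) + (s + suc b) ∎)
            where
            s≥1 : 1 ≤ s
            s≥1 = path-nonempty (proj₂ ear)
            m≤ms : m ≤ m * s
            m≤ms = ℕ.m≤m*n m s ⦃ ℕ.>-nonZero s≥1 ⦄
            k≤mk : k ≤ m * k
            k≤mk = ℕ.m≤n*m k m ⦃ ℕ.>-nonZero (ℕ.≤-<-trans z≤n r<m) ⦄
            regroup : ∀ a′ a s b → (a′ + a) + (s + b) ≡ (a′ + s) + (a + b)
            regroup = solve-∀
            split : ∀ m k b p → (suc m + suc (k + b)) + suc p ≡ (m + k + suc p + 1) + suc b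
            split = solve-∀
            collect : ∀ m s k r b → (m * s + m * k + suc (m * r) + s) + b ≡ suc (m * (s + (k + r))) + (s + b)
            collect = solve-∀

      -- The greedy choice starts in the deepest subtree, with a path from its root to a vertex
      -- whose neighbour on the branch is as high as possible.
      depth-bound : 1 < D → D + D ≤ suc m * suc m
      depth-bound 1<D with backEdge 0 1<D
      ... | j , x₀ , 1<j , j≤D , x₀∈ , x₀~j with greatest (touches? 0) D j≤D (x₀ , x₀∈ , x₀~j)
      ... | a , a≤D , (x , x∈ , x~a) , highest =
        lengthen D 0 (ℕ.m≤m+n D a) 1<a a≤D p e x~a (λ x∈ j≤D e → highest j≤D (_ , x∈ , e)) bound
        where
        open ℕ.≤-Reasoning
        l = link 0 (ℕ.<⇒≤ 1<D)
        1<a : 1 < a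
        1<a = ℕ.<-≤-trans 1<j (highest j≤D (x₀ , x₀∈ , x₀~j))
        across : ∃ (Path (subtree 0) x (vertex 0))
        across = reach (Link.w∈T l) (λ U U⊆ r∈U y∈ y∉U →
          let u , w , _ , u∈U , w∈S , w∉U , u~w = Link.connected l U (Link.w∈T l) r∈U y∈ y∉U
          in u , w , u∈U , w∈S , w∉U , u~w) x∈
        r = proj₁ across
        p : Path (subtree 0) (vertex 0) x r
        p = reversed (proj₂ across)
        e = Adj-sym (Link.edge l)
        bound : a + 1 ≤ suc (m * r)
        bound = ℕ.+-cancelʳ-≤ r _ _ (begin
          a + 1 + r         ≡⟨ regroup a r ⟩
          suc (a + r)       ≤⟨ s≤s (closeUp 0 1<a a≤D p e x~a) ⟩
          suc (suc m + 0)   ≡⟨ rearrange m ⟩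
          suc m + 1         ≤⟨ ℕ.+-mono-≤ (s≤s (ℕ.m≤m*n m r ⦃ ℕ.>-nonZero (path-nonempty p) ⦄)) (path-nonempty p) ⟩
          suc (m * r) + r   ∎)
          where
          regroup : ∀ a r → a + 1 + r ≡ suc (a + r)
          regroup = solve-∀
          rearrange : ∀ m → suc (suc m + 0) ≡ suc m + 1
          rearrange = solve-∀

  smallest : ∀ {n} {P : Subset n → Set} → Decidable P → ∀ {S} → P S →
             ∃ λ T → P T × (∀ {U} → P U → ∣ T ∣ ≤ ∣ U ∣)
  smallest {n} {P} P? {S} pS = go ∣ S ∣ pS ℕ.≤-refl
    where
    go : ∀ f {S} → P S → ∣ S ∣ ≤ f → ∃ λ T → P T × (∀ {U} → P U → ∣ T ∣ ≤ ∣ U ∣)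
    go f {S} pS S≤f with anySubset? (λ U → P? U ×-dec (∣ U ∣ ℕ.<? ∣ S ∣))
    ... | no ¬smaller = S , pS , λ {U} pU → ℕ.≮⇒≥ λ U<S → ¬smaller (U , pU , U<S)
    go zero    pS S≤f | yes (U , pU , U<S) = contradiction (ℕ.<-≤-trans U<S S≤f) λ ()
    go (suc f) pS S≤f | yes (U , pU , U<S) = go f pU (ℕ.≤-pred (ℕ.<-≤-trans U<S S≤f))

  pronic : ℕ → ℕ
  pronic zero    = 1
  pronic (suc d) = pronic d * suc (pronic d)

  -- The hat guessing game on a set of vertices.

  module HatGame {n : ℕ} (G : Graph n) (q : ℕ) where
    open Graph G
    open Branches G

    -- A crossing edge can be searched for exhaustively, so connectedness may be proved by
    -- contradiction, as the minimality arguments require.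
    connected-stable : ∀ {S} →
      (∀ U {x y} → x ∈ S → x ∈ U → y ∈ S → y ∉ U →
         ¬ (∀ {u w} → u ∈ S → u ∈ U → w ∈ S → w ∉ U → ¬ Adj u w)) → Connected S
    connected-stable {S} ¬separated U x∈S x∈U y∈S y∉U
      with any? (λ u → any? λ w → (u ∈? S) ×-dec (u ∈? U) ×-dec (w ∈? S) ×-dec ¬? (w ∈? U) ×-dec Adj? u w)
    ... | yes e = e
    ... | no ¬e = ⊥-elim (¬separated U x∈S x∈U y∈S y∉U λ a b c d e → ¬e (_ , _ , a , b , c , d , e))

    Isolated : Subset n → Subset n → Set
    Isolated T R = ∀ x → x ∈ T → ∀ y → y ∈ R → Adj x y → y ∈ T

    Isolated? : ∀ T R → Dec (Isolated T R)
    Isolated? T R = all? λ x → (x ∈? T) →-dec all? λ y → (y ∈? R) →-dec Adj? x y →-dec (y ∈? T)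

    -- A smallest nonempty isolated set is connected: if no edge crossed `U`, then `T ∩ U` would be
    -- a smaller one.
    component : ∀ {R x} → x ∈ R → ∃ λ T → T ⊆ R × Nonempty T × Isolated T R × Connected T
    component {R} x∈R
      with smallest (λ T → (T ⊆? R) ×-dec nonempty? T ×-dec Isolated? T R)
                    ((λ y∈ → y∈) , (_ , x∈R) , λ _ _ _ y∈ _ → y∈)
    ... | T , (T⊆R , T≠∅ , isolated) , T-least =
      T , T⊆R , T≠∅ , isolated , connected-stable λ U {x} {y} x∈T x∈U y∈T y∉U ¬e →
        ℕ.≤⇒≯ (T-least {T ∩ U} (T⊆R ∘ p∩q⊆p T U , (x , x∈p∩q⁺ (x∈T , x∈U)) , separated U ¬e))
          (p⊂q⇒∣p∣<∣q∣ (p∩q⊆p T U , y , y∈T , y∉U ∘ p∩q⊆q T U))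
      where
      separated : ∀ U → (∀ {u w} → u ∈ T → u ∈ U → w ∈ T → w ∉ U → ¬ Adj u w) → Isolated (T ∩ U) R
      separated U ¬e x x∈ y y∈R e with x∈p∩q⁻ T U x∈ | isolated x (p∩q⊆p T U x∈) y y∈R e | y ∈? U
      ... | _ , _     | y∈T | yes y∈U = x∈p∩q⁺ (y∈T , y∈U)
      ... | x∈T , x∈U | y∈T | no  y∉U = contradiction e (¬e x∈T x∈U y∈T y∉U)

    Colouring : Set
    Colouring = Fin n → Fin q

    mix : Subset n → Colouring → Colouring → Colouring
    mix S ψ φ u = if does (u ∈? S) then ψ u else φ u

    mix-∈ : ∀ {S} ψ φ {u} → u ∈ S → mix S ψ φ u ≡ ψ u
    mix-∈ {S} ψ φ {u} u∈S = cong (λ b → if b then ψ u else φ u) (dec-true (u ∈? S) u∈S)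

    mix-∉ : ∀ {S} ψ φ {u} → u ∉ S → mix S ψ φ u ≡ φ u
    mix-∉ {S} ψ φ {u} u∉S = cong (λ b → if b then ψ u else φ u) (dec-false (u ∈? S) u∉S)

    paint : Fin n → Fin q → Colouring → Colouring
    paint v a = mix ⁅ v ⁆ λ _ → a

    paint-≡ : ∀ v a φ → paint v a φ v ≡ a
    paint-≡ v a φ = mix-∈ (λ _ → a) φ (x∈⁅x⁆ _)

    paint-≢ : ∀ {v a} φ {u} → u ≢ v → paint v a φ u ≡ φ u
    paint-≢ {a = a} φ u≢v = mix-∉ (λ _ → a) φ (u≢v ∘ x∈⁅y⁆⇒x≡y _)

    -- Guesses are generalised to relations: when a part hanging at p is deleted, the new "guess" of p
    -- is the colour of p that does not extend to the deleted part, which need not exist.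
    record Game (V : Subset n) : Set₁ where
      field
        Bad    : Fin n → Colouring → Fin q → Set
        Bad?   : ∀ v φ x → Dec (Bad v φ x)
        unique : ∀ {v φ x y} → Bad v φ x → Bad v φ y → x ≡ y
        local  : ∀ {v φ ψ x} → v ∈ V → (∀ {u} → u ∈ V → Adj u v → φ u ≡ ψ u) → Bad v φ x → Bad v ψ x

      transfer : ∀ {v φ ψ x y} → v ∈ V → (∀ {u} → u ∈ V → Adj u v → φ u ≡ ψ u) → x ≡ y →
                 ¬ Bad v ψ y → ¬ Bad v φ x
      transfer v∈V agree refl ¬bad = ¬bad ∘ local v∈V agree

      -- Pigeonhole: if all of the first `m + 1` colours were bad, two of them would be bad against
      -- the same one of the `m` colourings, contrary to `unique`.
      avoid : ∀ {m} (Φ : Fin m → Colouring) (m<q : m < q) v →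
              ∃ λ i → ∀ j → ¬ Bad v (Φ j) (inject≤ {suc m} i m<q)
      avoid {m} Φ m<q v with any? (λ i → all? λ j → ¬? (Bad? v (Φ j) (inject≤ {suc m} i m<q)))
      ... | yes good = good
      ... | no ¬good =
        let i , i′ , i<i′ , same = Fin.pigeonhole ℕ.≤-refl (proj₁ ∘ witness)
        in contradiction
             (Fin.inject≤-injective m<q m<q i i′
                (unique (proj₂ (witness i))
                (subst (λ j → Bad v (Φ j) (inject≤ i′ m<q)) (sym same) (proj₂ (witness i′)))))
             (Fin.<⇒≢ i<i′)
        where
        witness : ∀ i → ∃ λ j → Bad v (Φ j) (inject≤ i m<q)
        witness i with any? (λ j → Bad? v (Φ j) (inject≤ i m<q))
        ... | yes bad = bad
        ... | no ¬bad = contradiction (i , λ j bad → ¬bad (j , bad)) ¬good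

      Solves : ∀ {m} → Subset n → (Fin m → Colouring) → Colouring → Set
      Solves S Φ ψ = ∀ j {v} → v ∈ S → ¬ Bad v (mix S ψ (Φ j)) (ψ v)

      Loses : Colouring → Set
      Loses φ = ∀ {v} → v ∈ V → ¬ Bad v φ (φ v)

      -- Different components do not see each other, so their solutions can be merged. One component
      -- `T` is split off at a time; what is isolated in `R ─ T` is also isolated in `R`.
      solveComponents : Colouring → ∀ {m} (Φ : Fin m → Colouring) f {R} → ∣ R ∣ ≤ f → R ⊆ V →
        (∀ {T} → T ⊆ R → Nonempty T → Isolated T R → Connected T → ∃ (Solves T Φ)) → ∃ (Solves R Φ)
      solveComponents default Φ f {R} R≤f R⊆V solve with nonempty? R
      ... | no  R=∅ = default , λ j v∈R → contradiction (_ , v∈R) R=∅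
      ... | yes (r , r∈R) with component r∈R
      ... | T , T⊆R , (t , t∈T) , isolated , connected with f | solve T⊆R (t , t∈T) isolated connected
      ... | zero  | _ = contradiction (ℕ.<-≤-trans (x∈p⇒∣p-x∣<∣p∣ r∈R) R≤f) λ ()
      ... | suc f | ψ , ψ-solves =
        let χ , χ-solves = solveComponents default Φ f (ℕ.≤-pred (ℕ.<-≤-trans smaller R≤f))
              (R⊆V ∘ p─q⊆p R T) rest
        in mix T ψ χ , combined χ χ-solves
        where
        smaller : ∣ R ─ T ∣ < ∣ R ∣
        smaller = p∩q≢∅⇒∣p─q∣<∣p∣ R T (t , x∈p∩q⁺ (T⊆R t∈T , t∈T))

        rest : ∀ {T′} → T′ ⊆ R ─ T → Nonempty T′ → Isolated T′ (R ─ T) → Connected T′ → ∃ (Solves T′ Φ)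
        rest T′⊆ T′≠∅ isolated′ = solve (p─q⊆p R T ∘ T′⊆) T′≠∅ λ x x∈ y y∈R e →
          isolated′ x x∈ y (x∈p∧x∉q⇒x∈p─q y∈R λ y∈T →
            x∈p─q⇒x∉q (T′⊆ x∈) (isolated y y∈T x (p─q⊆p R T (T′⊆ x∈)) (Adj-sym e))) e

        combined : ∀ χ → Solves (R ─ T) Φ χ → Solves R Φ (mix T ψ χ)
        combined χ χ-solves j {v} v∈R with v ∈? T
        ... | yes v∈T = transfer (R⊆V v∈R) agree refl (ψ-solves j v∈T)
          where
          agree : ∀ {u} → u ∈ V → Adj u v → mix R (mix T ψ χ) (Φ j) u ≡ mix T ψ (Φ j) u
          agree {u} _ e with u ∈? R | u ∈? T
          ... | yes u∈R | no u∉T = contradiction (isolated v v∈T u u∈R (Adj-sym e)) u∉T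
          ... | yes _   | yes _  = refl
          ... | no  _   | no _   = refl
          ... | no  u∉R | yes u∈T = contradiction (T⊆R u∈T) u∉R
        ... | no  v∉T = transfer (R⊆V v∈R) agree refl (χ-solves j (x∈p∧x∉q⇒x∈p─q v∈R v∉T))
          where
          agree : ∀ {u} → u ∈ V → Adj u v → mix R (mix T ψ χ) (Φ j) u ≡ mix (R ─ T) χ (Φ j) u
          agree {u} _ e with u ∈? R | u ∈? T | u ∈? (R ─ T)
          ... | _       | yes u∈T | _ = contradiction (isolated u u∈T v v∈R e) v∉T
          ... | yes _   | no _    | yes _ = refl
          ... | yes u∈R | no u∉T  | no u∉ = contradiction (x∈p∧x∉q⇒x∈p─q u∈R u∉T) u∉
          ... | no  u∉R | no _    | yes u∈ = contradiction (p─q⊆p R T u∈) u∉R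
          ... | no  _   | no _    | no _ = refl

    -- `S` and `p` may together exhaust `V`, so `p` need not be a cut vertex: every edge inside `V`
    -- yields a cut.
    Cut : Subset n → Subset n → Fin n → Set
    Cut V S p = S ⊆ V × p ∈ V × p ∉ S × (∃ λ x → x ∈ S × Adj p x) ×
                (∀ x → x ∈ S → ∀ y → y ∈ V → Adj x y → y ∈ S ⊎ y ≡ p)

    Cut? : ∀ V S p → Dec (Cut V S p)
    Cut? V S p = (S ⊆? V) ×-dec (p ∈? V) ×-dec ¬? (p ∈? S) ×-dec
                 any? (λ x → (x ∈? S) ×-dec Adj? p x) ×-dec
                 all? λ x → (x ∈? S) →-dec all? λ y → (y ∈? V) →-dec Adj? x y →-dec
                   ((y ∈? S) ⊎-dec (y ≟ p))

    push : Fin n × Subset n → Branch → Branch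
    push τ σ zero    = τ
    push τ σ (suc i) = σ i

    -- Deleting a minimal cut-off set.

    module MinimalCut {V S : Subset n} {p : Fin n} (cut : Cut V S p)
                      (minimal : ∀ {T v} → Cut V T v → ∣ S ∣ ≤ ∣ T ∣)
                      (game : Game V)
                      (shallow : ∀ {σ D} → 0 < D → IsBranch σ D → pronic D < q) where
      open Game game

      S⊆V : S ⊆ V
      S⊆V = proj₁ cut

      p∈V : p ∈ V
      p∈V = proj₁ (proj₂ cut)

      p∉S : p ∉ S
      p∉S = proj₁ (proj₂ (proj₂ cut))

      isolated : ∀ {x y} → x ∈ S → y ∈ V → Adj x y → y ∈ S ⊎ y ≡ p
      isolated x∈S = proj₂ (proj₂ (proj₂ (proj₂ cut))) _ x∈S _

      S∪p⊆V : S ∪ ⁅ p ⁆ ⊆ V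
      S∪p⊆V x∈ = [ S⊆V , (λ x∈p → subst (_∈ V) (sym (x∈⁅y⁆⇒x≡y p x∈p)) p∈V) ]′ (x∈p∪q⁻ S ⁅ p ⁆ x∈)

      -- If no edge crossed `U`, then the one of `S ∩ U` and `S ─ U` that contains a neighbour of
      -- `p` would be a smaller cut-off set.
      S-connected : Connected S
      S-connected = connected-stable λ U {x} {y} x∈S x∈U y∈S y∉U ¬e →
        let z , z∈S , p~z = proj₁ (proj₂ (proj₂ (proj₂ cut)))
        in case z ∈? U of λ where
          (yes z∈U) → ℕ.≤⇒≯ (minimal (S⊆V ∘ p∩q⊆p S U , p∈V , p∉S ∘ p∩q⊆p S U ,
                               (z , x∈p∩q⁺ (z∈S , z∈U) , p~z) , inside U ¬e))
                        (p⊂q⇒∣p∣<∣q∣ (p∩q⊆p S U , y , y∈S , y∉U ∘ p∩q⊆q S U))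
          (no z∉U) → ℕ.≤⇒≯ (minimal (S⊆V ∘ p─q⊆p S U , p∈V , p∉S ∘ p─q⊆p S U ,
                              (z , x∈p∧x∉q⇒x∈p─q z∈S z∉U , p~z) , outside U ¬e))
                        (p⊂q⇒∣p∣<∣q∣ (p─q⊆p S U , x , x∈S , λ x∈ → x∈p─q⇒x∉q x∈ x∈U))
        where
        module _ (U : Subset n) (¬e : ∀ {u w} → u ∈ S → u ∈ U → w ∈ S → w ∉ U → ¬ Adj u w) where
          inside : ∀ x → x ∈ S ∩ U → ∀ y → y ∈ V → Adj x y → y ∈ S ∩ U ⊎ y ≡ p
          inside x x∈ y y∈V e with x∈p∩q⁻ S U x∈
          ... | x∈S , x∈U with isolated x∈S y∈V e | y ∈? U
          ... | inj₂ y≡p | _       = inj₂ y≡p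
          ... | inj₁ y∈S | yes y∈U = inj₁ (x∈p∩q⁺ (y∈S , y∈U))
          ... | inj₁ y∈S | no  y∉U = contradiction e (¬e x∈S x∈U y∈S y∉U)

          outside : ∀ x → x ∈ S ─ U → ∀ y → y ∈ V → Adj x y → y ∈ S ─ U ⊎ y ≡ p
          outside x x∈ y y∈V e with isolated (p─q⊆p S U x∈) y∈V e | y ∈? U
          ... | inj₂ y≡p | _       = inj₂ y≡p
          ... | inj₁ y∈S | yes y∈U = contradiction (Adj-sym e) (¬e y∈S y∈U (p─q⊆p S U x∈) (x∈p─q⇒x∉q x∈))
          ... | inj₁ y∈S | no  y∉U = inj₁ (x∈p∧x∉q⇒x∈p─q y∈S y∉U)

      record Descent (σ : Branch) (D : ℕ) : Set where
        field
          branch : IsBranch σ D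
          small  : proj₂ (σ 0) ⊆ S
          top    : S ∪ ⁅ p ⁆ ⊆ proj₂ (σ D)
        open IsBranch branch public

      -- Otherwise v would cut off a set smaller than S.
      secondContact : ∀ {σ D T} → Descent σ D → Link (σ 0) (T) →
        ∃₂ λ x y → x ∈ proj₂ T × y ∈ V × y ∉ proj₂ T × y ≢ proj₁ (σ 0) × Adj x y
      secondContact {σ} {D} {w , T} descent link
        with any? (λ x → any? λ y →
               (x ∈? T) ×-dec (y ∈? V) ×-dec ¬? (y ∈? T) ×-dec ¬? (y ≟ proj₁ (σ 0)) ×-dec Adj? x y)
      ... | yes found = found
      ... | no ¬found = contradiction
            (minimal {T} {v} ((λ x∈ → S⊆V (small (T⊆S x∈))) , S⊆V (small v∈S) , v∉T ,
                            (w , w∈T , edge) , closed′))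
            (ℕ.<⇒≱ (ℕ.<-≤-trans (p⊂q⇒∣p∣<∣q∣ (T⊆S , v , v∈S , v∉T)) (p⊆q⇒∣p∣≤∣q∣ small)))
        where
        open Descent descent using (small)
        open Link link using (v; v∈S; v∉T; T⊆S; w∈T; edge)
        closed′ : ∀ x → x ∈ T → ∀ y → y ∈ V → Adj x y → y ∈ T ⊎ y ≡ v
        closed′ x x∈T y y∈V e with y ∈? T | y ≟ v
        ... | yes y∈T | _       = inj₁ y∈T
        ... | _       | yes y≡v = inj₂ y≡v
        ... | no y∉T  | no y≢v  = contradiction (x , y , x∈T , y∈V , y∉T , y≢v , e) ¬found

      -- Only the back edge of the new deepest subtree is missing. The neighbour `y` from
      -- `secondContact` lies in `S` or is `p`, so it enters the chain of subtrees at some position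
      -- `suc i`. As `x` lies in all of them, `closed` forces `y` to be the vertex there; `push`
      -- shifts its position to `suc (suc i)`.
      descend : ∀ {σ D τ} → Descent σ D → Link (σ 0) τ → Descent (push τ σ) (suc D)
      descend {σ} {D} {τ} descent newLink = record
        { branch = record
          { link     = λ { zero _ → newLink ; (suc i) (s≤s i<D) → link i i<D }
          ; backEdge = λ { zero _ → second
                         ; (suc i) (s≤s i<D) → let j , x , i<j , j≤D , e = backEdge i i<D
                                               in suc j , x , s≤s i<j , s≤s j≤D , e } }
        ; small = λ x∈ → small (T⊆S x∈)
        ; top   = top }
        where
        open Descent descent
        open Link newLink using (T⊆S; closed)

        second : ∃₂ λ j x → 1 < j × j ≤ suc D × x ∈ proj₂ τ × Adj x (proj₁ (push τ σ j))
        second with secondContact descent newLink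
        ... | x , y , x∈T , y∈V , y∉T , y≢v , x~y
          with y ∈? subtree 0
        ... | yes y∈ = [ (λ y∈T → contradiction y∈T y∉T) , (λ y≡v → contradiction y≡v y≢v) ]′ (closed x∈T y∈ x~y)
        ... | no y∉
          with locate subtree 0 D y∉ (subst (λ i → y ∈ subtree i) (sym (ℕ.+-identityʳ D))
                 (top (x∈p∪q⁺ ([ inj₁ , (λ y≡p → inj₂ (subst (_∈ ⁅ p ⁆) (sym y≡p) (x∈⁅x⁆ p))) ]′
                   (isolated (small (T⊆S x∈T)) y∈V x~y)))))
        ... | i , i<D , y∉i , y∈i with ℕ.+-identityʳ i
        ... | i≡ = suc (suc i) , x , s≤s (s≤s z≤n) , s≤s i<D , x∈T ,
          subst (Adj x) (y-is-vertex (subst (λ k → y ∉ subtree k) i≡ y∉i)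
                               (subst (λ k → y ∈ subtree (suc k)) i≡ y∈i)) x~y
          where
          y-is-vertex : y ∉ subtree i → y ∈ subtree (suc i) → y ≡ vertex (suc i)
          y-is-vertex y∉i y∈i =
            [ (λ y∈ → contradiction y∈ y∉i) , id ]′
              (Link.closed (link i i<D) (up i (ℕ.<⇒≤ i<D)) y∈i x~y)
            where
            up : ∀ k → k ≤ D → x ∈ subtree k
            up zero    _  = T⊆S x∈T
            up (suc k) lt = Link.T⊆S (link k lt) (up k (ℕ.<⇒≤ lt))

      solveSubtree : Colouring → ∀ f {σ D} → 0 < D → Descent σ D → ∣ proj₂ (σ 0) ∣ ≤ f →
        (Φ : Fin (pronic D) → Colouring) → ∃ (Solves (proj₂ (σ 0)) Φ)
      solveSubtree default f {σ} {suc d} 0<D descent size Φ = solve f size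
        where
        open Descent descent
        D = suc d
        v = vertex 0
        Sᵥ = subtree 0
        R = Sᵥ - v
        l = link 0 0<D
        few : pronic D < q
        few = shallow 0<D branch
        v∈S : v ∈ Sᵥ
        v∈S = Link.w∈T l
        R<S : ∣ R ∣ < ∣ Sᵥ ∣
        R<S = x∈p⇒∣p-x∣<∣p∣ v∈S
        R⊆S : R ⊆ Sᵥ
        R⊆S = p─q⊆p Sᵥ ⁅ v ⁆
        v∉R : v ∉ R
        v∉R v∈R = x∈p─q⇒x∉q v∈R (x∈⁅x⁆ v)

        -- An index stands for a pair of a given colouring and one of `pronic D + 1` candidate
        -- colours of `v`; this is the recursion of `pronic`.
        Φ′ : Fin (pronic (suc D)) → Colouring
        Φ′ k = let j , i = remQuot (suc (pronic D)) k in paint v (inject≤ i few) (Φ j)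

        newLink : ∀ {T} → T ⊆ R → Nonempty T → Isolated T R → Connected T → ∃ λ w → Link (v , Sᵥ) (w , T)
        newLink {T} T⊆R (t , t∈T) iso connected
          -- Connectedness of `Sᵥ` gives an edge leaving `T`; as `T` is isolated in `R`, it must end
          -- at `v`.
          with Link.connected l T (R⊆S (T⊆R t∈T)) t∈T v∈S (v∉R ∘ T⊆R)
        ... | u , w , u∈S , u∈T , w∈S , w∉T , u~w with w ≟ v
        ... | no w≢v = contradiction (iso u u∈T w (x∈p∧x≢y⇒x∈p-y w∈S w≢v) u~w) w∉T
        ... | yes refl = u , record
          { v∈S = v∈S ; v∉T = v∉R ∘ T⊆R ; T⊆S = R⊆S ∘ T⊆R ; w∈T = u∈T ; edge = Adj-sym u~w
          ; connected = connected ; closed = closed }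
          where
          closed : ∀ {x y} → x ∈ T → y ∈ Sᵥ → Adj x y → y ∈ T ⊎ y ≡ v
          closed {x} {y} x∈T y∈S e with y ≟ v
          ... | yes y≡v = inj₂ y≡v
          ... | no  y≢v = inj₁ (iso x x∈T y (x∈p∧x≢y⇒x∈p-y y∈S y≢v) e)

        solve : ∀ f → ∣ Sᵥ ∣ ≤ f → ∃ (Solves Sᵥ Φ)
        solve zero    S≤0 = contradiction (ℕ.<-≤-trans R<S S≤0) λ ()
        solve (suc f) S≤f with solveComponents default Φ′ f (ℕ.≤-pred (ℕ.<-≤-trans R<S S≤f)) (S⊆V ∘ small ∘ R⊆S)
          (λ {T} T⊆R T≠∅ iso connected →
            let w , new = newLink T⊆R T≠∅ iso connected
            in solveSubtree default f (s≤s z≤n) (descend descent new)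
                 (ℕ.≤-pred (ℕ.<-≤-trans (ℕ.≤-<-trans (p⊆q⇒∣p∣≤∣q∣ T⊆R) R<S) S≤f)) Φ′)
        -- `v` is coloured last. Its guesses do not depend on its own colour, so there is one guess
        -- per `j`, and some candidate `i` escapes them all; `ψ` already copes with every pair
        -- `(j , i)`.
        ... | ψ , ψ-solves with avoid (λ j → mix R ψ (Φ j)) few v
        ... | i , good = ψ′ , solves
          where
          a = inject≤ i few
          ψ′ = paint v a ψ

          agree : ∀ j {w} → w ≢ v → mix Sᵥ ψ′ (Φ j) w ≡ mix R ψ (Φ j) w
          agree j {w} w≢v with w ∈? Sᵥ | w ∈? R
          ... | yes _   | yes _   = paint-≢ ψ w≢v
          ... | yes w∈S | no  w∉R = contradiction (x∈p∧x≢y⇒x∈p-y w∈S w≢v) w∉R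
          ... | no  w∉S | yes w∈R = contradiction (R⊆S w∈R) w∉S
          ... | no  _   | no  _   = refl

          painted : ∀ j w → mix Sᵥ ψ′ (Φ j) w ≡ mix R ψ (paint v a (Φ j)) w
          painted j w with w ≟ v
          ... | yes refl = trans (mix-∈ ψ′ (Φ j) v∈S) (trans (paint-≡ v a ψ)
            (sym (trans (mix-∉ ψ (paint v a (Φ j)) v∉R) (paint-≡ v a (Φ j)))))
          ... | no  w≢v  = trans (agree j w≢v) repaint
            where
            repaint : mix R ψ (Φ j) w ≡ mix R ψ (paint v a (Φ j)) w
            repaint with w ∈? R
            ... | yes _ = refl
            ... | no  _ = sym (paint-≢ (Φ j) w≢v)

          solves : Solves Sᵥ Φ ψ′
          solves j {u} u∈S with u ≟ v
          ... | yes refl = transfer (S⊆V (small v∈S))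
                  (λ _ e → agree j λ { refl → Adj-irrefl e }) (paint-≡ v a ψ) (good j)
          ... | no  u≢v  = transfer (S⊆V (small u∈S))
                  (λ {w} _ _ → trans (painted j w)
                    (cong (λ (j , i) → mix R ψ (paint v (inject≤ i few) (Φ j)) w)
                          (sym (Fin.remQuot-combine {k = suc (pronic D)} j i))))
                  (paint-≢ ψ u≢v) (ψ-solves (combine j i) (x∈p∧x≢y⇒x∈p-y u∈S u≢v))

      w : Fin n
      w = proj₁ (proj₁ (proj₂ (proj₂ (proj₂ cut))))

      root : Branch
      root = push (w , S) λ _ → p , S ∪ ⁅ p ⁆

      rootDescent : Descent root 1
      rootDescent = record
        { branch = record
          { link = λ { zero _ → record
              { v∈S = x∈p∪q⁺ (inj₂ (x∈⁅x⁆ p)) ; v∉T = p∉S ; T⊆S = x∈p∪q⁺ ∘ inj₁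
              ; w∈T = proj₁ (proj₂ (proj₁ (proj₂ (proj₂ (proj₂ cut)))))
              ; edge = proj₂ (proj₂ (proj₁ (proj₂ (proj₂ (proj₂ cut)))))
              ; connected = S-connected
              ; closed = λ x∈S y∈ e → isolated x∈S (S∪p⊆V y∈) e }
                     ; (suc _) (s≤s ()) }
          ; backEdge = λ { _ (s≤s ()) } }
        ; small = λ x∈ → x∈
        ; top   = λ x∈ → x∈ }

      -- Outside itself `S` sees only `p`, so a constant colouring represents all colourings that
      -- give `p` this colour. At depth 1 there is room for `pronic 1`, that is two, of them.
      answer : ∀ x y → ∃ (Solves S _)
      answer x y = solveSubtree (λ _ → x) ∣ S ∣ (s≤s z≤n) rootDescent ℕ.≤-refl
                     λ { zero _ → x ; (suc _) _ → y }

      reply : Fin q → Fin q → Colouring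
      reply x y = proj₁ (answer x y)

      reply-solves : ∀ x y φ → φ p ≡ x ⊎ φ p ≡ y → ∀ {v} → v ∈ S → ¬ Bad v (mix S (reply x y) φ) (reply x y v)
      reply-solves x y φ φp {v} v∈S = case φp of λ where
          (inj₁ φp≡x) → transfer (S⊆V v∈S) (agree φp≡x) refl (proj₂ (answer x y) zero v∈S)
          (inj₂ φp≡y) → transfer (S⊆V v∈S) (agree φp≡y) refl (proj₂ (answer x y) (suc zero) v∈S)
        where
        agree : ∀ {c} → φ p ≡ c → ∀ {u} → u ∈ V → Adj u v → mix S (reply x y) φ u ≡ mix S (reply x y) (λ _ → c) u
        agree φp≡c {u} u∈V e with u ∈? S | isolated v∈S u∈V (Adj-sym e)
        ... | yes _   | _         = refl
        ... | no  _   | inj₂ refl = φp≡c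
        ... | no  u∉S | inj₁ u∈S  = contradiction u∈S u∉S

      -- Two bad colours x and y of p would both be bad against the reply to this pair.
      Unextendable : Colouring → Fin q → Set
      Unextendable φ x = ∀ y → Bad p (mix S (reply x y) φ) x × Bad p (mix S (reply y x) φ) x

      mix-agree : ∀ ψ {φ χ v} → (∀ {u} → u ∈ V ─ S → Adj u v → φ u ≡ χ u) →
                  ∀ {u} → u ∈ V → Adj u v → mix S ψ φ u ≡ mix S ψ χ u
      mix-agree ψ agree {u} u∈V e with u ∈? S
      ... | yes _   = refl
      ... | no  u∉S = agree (x∈p∧x∉q⇒x∈p─q u∈V u∉S) e

      unseen : ∀ {v} → v ∈ V ─ S → v ≢ p → ∀ {u} → u ∈ V → Adj u v → u ∉ S
      unseen v∈ v≢p u∈V e u∈S = [ x∈p─q⇒x∉q v∈ , v≢p ]′ (isolated u∈S (p─q⊆p V S v∈) e)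

      -- Only the guess of `p` changes, since no other remaining vertex sees `S`. The colouring of
      -- `S` in `Unextendable` is computed from colours of `p` alone, so the new guess still depends
      -- only on the remaining neighbours.
      outerGame : Game (V ─ S)
      outerGame = record
        { Bad    = λ v φ x → v ≡ p × Unextendable φ x ⊎ v ≢ p × Bad v φ x
        ; Bad?   = λ v φ x → (v ≟ p ×-dec all? λ y → Bad? p _ x ×-dec Bad? p _ x) ⊎-dec
                             (¬? (v ≟ p) ×-dec Bad? v φ x)
        ; unique = λ where
            -- Taking each colour as the partner of the other, both facts concern the same
            -- `reply x y`. The second component of `Unextendable` serves this, as `reply` need not
            -- be symmetric.
            (inj₁ (_ , bx))     (inj₁ (_ , by))     → unique (proj₁ (bx _)) (proj₂ (by _))
            (inj₂ (_ , bx))     (inj₂ (_ , by))     → unique bx by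
            (inj₁ (v≡p , _))    (inj₂ (v≢p , _))    → contradiction v≡p v≢p
            (inj₂ (v≢p , _))    (inj₁ (v≡p , _))    → contradiction v≡p v≢p
        ; local  = λ where
            v∈ agree (inj₁ (refl , b)) → inj₁ (refl , λ y →
              local p∈V (mix-agree (reply _ y) agree) (proj₁ (b y)) ,
              local p∈V (mix-agree (reply y _) agree) (proj₂ (b y)))
            v∈ agree (inj₂ (v≢p , b)) → inj₂ (v≢p , local (p─q⊆p V S v∈)
              (λ u∈V e → agree (x∈p∧x∉q⇒x∈p─q u∈V (unseen v∈ v≢p u∈V e)) e) b)
        }

      extended : ∀ {φ ψ} → Game.Loses outerGame φ →
                 (∀ {v} → v ∈ S → ¬ Bad v (mix S ψ φ) (ψ v)) → ¬ Bad p (mix S ψ φ) (φ p) → Loses (mix S ψ φ)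
      extended {φ} {ψ} φ-loses ψ-solves p-wrong {v} v∈V with v ∈? S
      ... | yes v∈S = ψ-solves v∈S
      ... | no  v∉S with v ≟ p
      ... | yes refl = p-wrong
      ... | no  v≢p  = transfer v∈V (λ u∈V e → mix-∉ ψ φ (unseen v∈ v≢p u∈V e)) refl
                         λ b → φ-loses v∈ (inj₂ (v≢p , b))
        where
        v∈ : v ∈ V ─ S
        v∈ = x∈p∧x∉q⇒x∈p─q v∈V v∉S

      -- The colour of `p` is not unextendable, so for some partner `y` and one of the two orders
      -- `p` guesses wrong against the reply; that reply colours `S`.
      extend : ∀ {φ} → Game.Loses outerGame φ → ∃ Loses
      extend {φ} φ-loses with Fin.¬∀⟶∃¬ q _
                                (λ y → Bad? p (mix S (reply (φ p) y) φ) (φ p) ×-dec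
                                       Bad? p (mix S (reply y (φ p)) φ) (φ p))
                                (λ b → φ-loses (x∈p∧x∉q⇒x∈p─q p∈V p∉S) (inj₁ (refl , b)))
      ... | y , ¬b with Bad? p (mix S (reply (φ p) y) φ) (φ p)
      ... | no ¬b₁ = _ , extended φ-loses (reply-solves (φ p) y φ (inj₁ refl)) ¬b₁
      ... | yes b₁ = _ , extended φ-loses (reply-solves y (φ p) φ (inj₂ refl)) λ b₂ → ¬b (b₁ , b₂)

    -- Induction on the number of vertices.

    module _ (shallow : ∀ {σ D} → 0 < D → IsBranch σ D → pronic D < q) (2<q : 2 < q) where

      edge⇒cut : ∀ {V x y} → x ∈ V → y ∈ V → Adj x y → Cut V (V - x) x
      edge⇒cut {V} {x} {y} x∈V y∈V e =
        p─q⊆p V ⁅ x ⁆ , x∈V , (λ x∈ → x∈p─q⇒x∉q x∈ (x∈⁅x⁆ x)) ,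
        (y , x∈p∧x≢y⇒x∈p-y y∈V (λ { refl → Adj-irrefl e }) , e) , closed
        where
        closed : ∀ u → u ∈ V - x → ∀ w → w ∈ V → Adj u w → w ∈ V - x ⊎ w ≡ x
        closed _ _ w w∈V _ with w ≟ x
        ... | yes w≡x = inj₂ w≡x
        ... | no  w≢x = inj₁ (x∈p∧x≢y⇒x∈p-y w∈V w≢x)

      loses : ∀ f {V} → ∣ V ∣ ≤ f → (game : Game V) → ∃ (Game.Loses game)
      loses f {V} V≤f game with anySubset? (λ S → any? (Cut? V S))
      -- Without a cut there are no edges, so each guess is constant and `base` may be any
      -- colouring.
      ... | no uncut = φ , λ {v} v∈V → transfer v∈V (λ u∈V e → contradiction (_ , _ , edge⇒cut u∈V v∈V e) uncut)
                                         refl (proj₂ (avoid base 1<q v) zero)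
        where
        open Game game
        1<q : 1 < q
        1<q = ℕ.<-trans (s≤s (s≤s z≤n)) 2<q
        base : Fin 1 → Colouring
        base _ _ = inject≤ zero 2<q
        φ : Colouring
        φ v = inject≤ (proj₁ (avoid base 1<q v)) 1<q
      ... | yes (S , p , cut) with smallest (λ S → any? (Cut? V S)) (p , cut)
      ... | S , (p , cut@(_ , _ , _ , (x , x∈S , _) , _)) , minimal = smaller f V≤f
        where
        open MinimalCut cut (λ c → minimal (_ , c)) game shallow
        smaller : ∀ f → ∣ V ∣ ≤ f → ∃ (Game.Loses game)
        smaller zero    V≤0 = contradiction (ℕ.<-≤-trans (x∈p⇒∣p-x∣<∣p∣ (S⊆V x∈S)) V≤0) λ ()
        smaller (suc f) V≤f = extend (proj₂ (loses f
          (ℕ.≤-pred (ℕ.<-≤-trans (p∩q≢∅⇒∣p─q∣<∣p∣ V S (x , x∈p∩q⁺ (S⊆V x∈S , x∈S))) V≤f)) outerGame))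

      playersLose : ¬ PlayersWin G q
      playersLose (Γ , winning) =
        let φ , φ-loses = loses n (ℕ.≤-reflexive (∣⊤∣≡n n)) guesses
            v , correct = winning φ
        in φ-loses ∈⊤ correct
        where
        guesses : Game ⊤
        guesses = record
          { Bad    = λ v φ x → Strategy.guess Γ v (φ ∘ proj₁) ≡ x
          ; Bad?   = λ v φ x → Strategy.guess Γ v (φ ∘ proj₁) ≟ x
          ; unique = λ gx gy → trans (sym gx) gy
          ; local  = λ {v} _ agree gx → trans (Strategy.guess-cong Γ v λ (u , e) → sym (agree ∈⊤ (Adj-sym e))) gx
          }

-- Numerical estimates and the final bound.

module Threshold where
  open HatGuessing using (pronic; module HatGame; module Branches)
  open import Data.Integer.Base as ℤ using (ℤ; +_; ∣_∣)
  import Data.Integer.Properties as ℤ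
  open import Data.Empty using (⊥-elim)
  open import Data.Nat.Base as ℕ using (ℕ; zero; suc; _+_; _*_; _≤_; _<_; z≤n; s≤s; ⌊_/2⌋)
  open import Data.Product.Base using (∃; _×_; _,_)
  open import Relation.Nullary using (¬_; yes; no; contradiction)
  import Data.Nat.Properties as ℕ
  open import Data.Nat.Coprimality as Coprime using (1-coprimeTo)
  open import Data.Rational.Base as ℚ using (ℚ; mkℚ; _/_; ½)
  import Data.Rational.Properties as ℚ
  open import Data.Rational.Solver using (module +-*-Solver)
  open import Data.Sum.Base using (_⊎_; inj₁; inj₂; [_,_]′)
  open import Function.Base using (id)
  open import Algebra.Bundles using (CommutativeRing)
  import Algebra.Properties.Semiring.Exp
  open import Relation.Nullary.Decidable using (from-yes)
  open import Relation.Binary.PropositionalEquality using (_≡_; sym; trans; cong; subst; subst₂; refl)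

  module Exp = Algebra.Properties.Semiring.Exp (CommutativeRing.semiring ℚ.+-*-commutativeRing)

  -- Already in lowest terms, whereas `+ a / 1` is normalised by a gcd that is stuck on a variable
  -- `a`.
  ι : ℕ → ℚ
  ι a = mkℚ (+ a) 0 (Coprime.sym (1-coprimeTo a))

  ι-/1 : ∀ a → + a / 1 ≡ ι a
  ι-/1 a = ℚ.↥p/↧p≡p (ι a)

  ι-mono : ∀ {a b} → a ≤ b → ι a ℚ.≤ ι b
  ι-mono a≤b = ℚ.*≤* (ℤ.*-monoʳ-≤-nonNeg (+ 1) (ℤ.+≤+ a≤b))

  ι-suc : ∀ a → ι (suc a) ≡ ι a ℚ.+ ℚ.1ℚ
  ι-suc a = trans (sym (ι-/1 (suc a)))
    (cong (_/ 1) (trans (cong +_ (ℕ.+-comm 1 a)) (cong (ℤ._+ + 1) (sym (ℤ.*-identityʳ (+ a))))))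

  ι-* : ∀ a b → ι (a * b) ≡ ι a ℚ.* ι b
  ι-* a b = trans (sym (ι-/1 (a * b))) (cong (_/ 1) (ℤ.pos-* a b))

  -- Expanding (A + 11/20)², the claim reduces to A/10 + 121/400 ≥ 11/20. This holds for A ≥ 6 =
  -- `pronic 2` but fails for A = 2 = `pronic 1`.
  pronic-step : ∀ A X → ι 6 ℚ.≤ A → A ℚ.+ + 11 / 20 ℚ.≤ X →
                A ℚ.* (A ℚ.+ ℚ.1ℚ) ℚ.+ + 11 / 20 ℚ.≤ X ℚ.* X
  pronic-step A X 6≤A A≤X = begin
    A ℚ.* (A ℚ.+ ℚ.1ℚ) ℚ.+ + 11 / 20
      ≤⟨ ℚ.+-monoʳ-≤ (A ℚ.* (A ℚ.+ ℚ.1ℚ)) (from-yes (+ 11 / 20 ℚ.≤? (+ 1 / 10) ℚ.* ι 6 ℚ.+ + 121 / 400)) ⟩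
    A ℚ.* (A ℚ.+ ℚ.1ℚ) ℚ.+ ((+ 1 / 10) ℚ.* ι 6 ℚ.+ + 121 / 400)
      ≤⟨ ℚ.+-monoʳ-≤ (A ℚ.* (A ℚ.+ ℚ.1ℚ)) (ℚ.+-monoˡ-≤ (+ 121 / 400) (ℚ.*-monoˡ-≤-nonNeg (+ 1 / 10) 6≤A)) ⟩
    A ℚ.* (A ℚ.+ ℚ.1ℚ) ℚ.+ ((+ 1 / 10) ℚ.* A ℚ.+ + 121 / 400)
      ≡⟨ solve 1 (λ a → a :* (a :+ con ℚ.1ℚ) :+ (con (+ 1 / 10) :* a :+ con (+ 121 / 400))
                     := (a :+ con (+ 11 / 20)) :* (a :+ con (+ 11 / 20))) refl A ⟩
    B ℚ.* B
      ≤⟨ ℚ.*-monoˡ-≤-nonNeg B ⦃ ℚ.nonNegative 0≤B ⦄ A≤X ⟩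
    B ℚ.* X
      ≤⟨ ℚ.*-monoʳ-≤-nonNeg X ⦃ ℚ.nonNegative (ℚ.≤-trans 0≤B A≤X) ⦄ A≤X ⟩
    X ℚ.* X ∎
    where
    open ℚ.≤-Reasoning
    open +-*-Solver
    B = A ℚ.+ + 11 / 20
    0≤B : ℚ.0ℚ ℚ.≤ B
    0≤B = ℚ.≤-trans (from-yes (ℚ.0ℚ ℚ.≤? ι 6 ℚ.+ + 11 / 20)) (ℚ.+-monoˡ-≤ (+ 11 / 20) 6≤A)

  pronic-mono : ∀ {d e} → d ≤ e → pronic d ≤ pronic e
  pronic-mono d≤e = go (ℕ.≤⇒≤′ d≤e)
    where
    go : ∀ {d e} → d ℕ.≤′ e → pronic d ≤ pronic e
    go ℕ.≤′-refl = ℕ.≤-refl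
    go (ℕ.≤′-step {e} p) = ℕ.≤-trans (go p) (ℕ.m≤m*n (pronic e) (suc (pronic e)))

  -- The constant 11/20 makes the induction work, but only from the second term on.
  pronic-below : ∀ d → ι (pronic (2 + d)) ℚ.+ + 11 / 20 ℚ.≤ [64/25]^2^⟨ 2 + d -1⟩
  -- This is 6.55 ≤ 2.56² = 6.5536, with very little to spare.
  pronic-below zero    = from-yes (ι (pronic 2) ℚ.+ + 11 / 20 ℚ.≤? [64/25]^2^⟨ 2 -1⟩)
  pronic-below (suc d) = subst₂ ℚ._≤_
    (cong (ℚ._+ + 11 / 20) (sym (trans (ι-* M (suc M)) (cong (ι M ℚ.*_) (ι-suc M)))))
    (sym square)
    (pronic-step (ι M) _ (ι-mono (pronic-mono {2} {2 + d} (s≤s (s≤s z≤n)))) (pronic-below d))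
    where
    M = pronic (2 + d)
    e = 2 ℕ.^ suc d
    square : (+ 64 / 25) ^ (2 ℕ.^ suc (suc d)) ≡ (+ 64 / 25) ^ e ℚ.* (+ 64 / 25) ^ e
    square = trans (Exp.^-homo-* (+ 64 / 25) e (e + 0))
      (cong (λ z → (+ 64 / 25) ^ e ℚ.* (+ 64 / 25) ^ z) (ℕ.+-identityʳ e))

  -- The alternative `h ≤ 2` is present because branches of depth 1 exist whatever the cycles are,
  -- and `pronic 1` is 2.
  colours-below : ∀ k {h} → h ≤ 2 ⊎ h ≤ pronic k → + h / 1 ℚ.< [64/25]^2^⟨ k -1⟩ ℚ.+ ½
  colours-below k {h} small = subst (ℚ._< [64/25]^2^⟨ k -1⟩ ℚ.+ ½) (sym (ι-/1 h)) (go k small)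
    where
    go : ∀ k → h ≤ 2 ⊎ h ≤ pronic k → ι h ℚ.< [64/25]^2^⟨ k -1⟩ ℚ.+ ½
    -- Here 2 < 8/5 + 1/2, while `pronic 0` is only 1.
    go zero    small = ℚ.≤-<-trans (ι-mono ([ id , ℕ.m≤n⇒m≤1+n ]′ small))
      (from-yes (ι 2 ℚ.<? [64/25]^2^⟨ 0 -1⟩ ℚ.+ ½))
    go (suc zero) small = ℚ.≤-<-trans (ι-mono ([ id , id ]′ small))
      (from-yes (ι 2 ℚ.<? [64/25]^2^⟨ 1 -1⟩ ℚ.+ ½))
    go (suc (suc d)) small = begin-strict
      ι h                        ≤⟨ ι-mono ([ (λ h≤2 → ℕ.≤-trans h≤2 (pronic-mono {1} {2 + d} (s≤s z≤n))) , id ]′ small) ⟩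
      ι M                        ≡⟨ ℚ.+-identityʳ (ι M) ⟨
      ι M ℚ.+ ℚ.0ℚ               ≤⟨ ℚ.+-monoʳ-≤ (ι M) (from-yes (ℚ.0ℚ ℚ.≤? + 11 / 20)) ⟩
      ι M ℚ.+ + 11 / 20          ≤⟨ pronic-below d ⟩
      X                          ≡⟨ ℚ.+-identityʳ X ⟨
      X ℚ.+ ℚ.0ℚ                 <⟨ ℚ.+-monoʳ-< X (from-yes (ℚ.0ℚ ℚ.<? ½)) ⟩
      X ℚ.+ ½                    ∎
      where
      open ℚ.≤-Reasoning
      M = pronic (2 + d)
      X = [64/25]^2^⟨ 2 + d -1⟩

  -- For c ≤ 0 there are no cycles at all, so the bound 1 on their lengths holds vacuously, and 2D ≤
  -- 1 excludes every depth above 1.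
  circumference-bound : (c : ℤ) → ∀ {n} (G : Graph n) → ¬ (∃ λ (C : Cycle G) → + Cycle.len C ℤ.> c) →
    ∃ λ m → (∀ (C : Cycle G) → Cycle.len C ≤ suc m) ×
            (∀ {D} → 1 < D → D + D ≤ suc m * suc m → D ≤ ⌊ ∣ c ℤ.* c ∣ /2⌋)
  circumference-bound (+ suc m) G ¬long =
    m , (λ C → ℕ.≮⇒≥ λ long → ¬long (C , ℤ.+<+ long)) ,
    λ {D} _ 2D≤c² → subst (_≤ ⌊ suc m * suc m /2⌋) (sym (ℕ.n≡⌊n+n/2⌋ D)) (ℕ.⌊n/2⌋-mono 2D≤c²)
  circumference-bound (+ zero) G ¬long =
    0 , (λ C → ⊥-elim (¬long (C , ℤ.+<+ (s≤s z≤n)))) ,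
    λ 1<D 2D≤1 → contradiction (ℕ.≤-trans (ℕ.m≤m+n _ _) 2D≤1) (ℕ.<⇒≱ 1<D)
  circumference-bound ℤ.-[1+ _ ] G ¬long =
    0 , (λ C → ⊥-elim (¬long (C , ℤ.-<+))) ,
    λ 1<D 2D≤1 → contradiction (ℕ.≤-trans (ℕ.m≤m+n _ _) 2D≤1) (ℕ.<⇒≱ 1<D)

  colours-bounded : ∀ {n} (G : Graph n) m k → (∀ (C : Cycle G) → Cycle.len C ≤ suc m) →
    (∀ {D} → 1 < D → D + D ≤ suc m * suc m → D ≤ k) →
    ∀ {h} → PlayersWin G h → + h / 1 ℚ.< [64/25]^2^⟨ k -1⟩ ℚ.+ ½
  colours-bounded G m k circumference halve {h} playersWin with h ℕ.≤? 2 | h ℕ.≤? pronic k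
  ... | yes h≤2 | _       = colours-below k (inj₁ h≤2)
  ... | no _    | yes h≤M = colours-below k (inj₂ h≤M)
  ... | no h≰2  | no h≰M  = contradiction playersWin (HatGame.playersLose G h shallow (ℕ.≰⇒> h≰2))
    where
    open Branches G using (IsBranch; depth-bound)
    shallow : ∀ {σ D} → 0 < D → IsBranch σ D → pronic D < h
    -- Depth 1 is covered by 2 < `h`; beyond it the cycle bound gives D ≤ `k`, and `pronic` is
    -- monotone.
    shallow {D = suc zero}    _ _      = ℕ.≰⇒> h≰2
    shallow {D = suc (suc d)} _ branch = ℕ.≤-<-trans
      (pronic-mono (halve 1<D (depth-bound m circumference branch 1<D))) (ℕ.≰⇒> h≰M)
      where
      1<D : 1 < suc (suc d)
      1<D = s≤s (s≤s z≤n)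

open import Data.Nat.Base using (ℕ; ⌊_/2⌋)
open import Data.Integer.Base using (ℤ; +_; ∣_∣; _*_; _>_)
open import Data.Product.Base using (∃; _,_)
open import Data.Rational.Base using (_/_; _+_; _<_; ½)
open import Relation.Nullary.Negation.Core using (¬_)

theorem1p2 : (c : ℤ) {n : ℕ} (G : Graph n) →
    ¬ (∃ λ (C : Cycle G) → + Cycle.len C > c) →
    (h : ℕ) → IsHG G h →
    (+ h / 1) < [64/25]^2^⟨ ⌊ ∣ c * c ∣ /2⌋ -1⟩ + ½
theorem1p2 c G noLongCycle h (playersWin , _) =
  let m , circumference , halve = Threshold.circumference-bound c G noLongCycle
  in Threshold.colours-bounded G m _ circumference halve playersWin
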